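{- Let $\omega=\mathcal{A}(\theta)$ ($\theta\in[0,1)$) be a positive quadratic irrational number and let $\omega'$ be its algebraic conjugate. Then (1) $\omega$ is a pure quadratic irrational number if and only if $\omega'<0$; (2) $\omega$ is a non-pure quadratic irrational number if and only if $\omega'>0$.
   Context: Stern's diatomic integers: $[2^0:0]=0$, $[2^0:1]=1$, $[2^{n+1}:2m]=[2^n:m]$, $[2^{n+1}:2m+1]=[2^n:m]+[2^n:m+1]$. Assembly function: the map $m/2^n\mapsto[2^n:m]/[2^n:2^n-m]$ ($0\le m\le 2^n-1$) extends uniquely to a continuous strictly increasing bijection $\mathcal{A}:[0,1)\to[0,\infty)$. An infinite design is an infinite binary sequence $d_1d_2\cdots$ that is not eventually constant, with design decimal $\theta_D=\sum_i d_i2^{ -i}$; it is purely periodic if $D=PPP\cdots$ for some nonempty finite binary word $P$. $\omega=\mathcal{A}(\theta)$ is a pure quadratic irrational number if $\theta=\theta_D$ for a purely periodic infinite design $D$, and a non-pure quadratic irrational number if it is a quadratic irrational but not pure. -}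

module Defs where

open import Data.Bool using (Bool; true; false; if_then_else_)
open import Data.Nat as ℕ using (ℕ; zero; suc; _+_; _*_; _∸_; _^_; _%_; _/_; _≡ᵇ_)
open import Data.Integer as ℤ using (ℤ; +_; -_)
open import Data.Product using (Σ; ∃; _×_; _,_)
open import Data.Sum using (_⊎_)
open import Relation.Binary.PropositionalEquality using (_≡_; _≢_)
open import Relation.Nullary using (¬_)

-- Stern's diatomic integers  stern n m = [2^n : m]   (0 ≤ m ≤ 2^n)
--   [2^0:0]=0, [2^0:1]=1,
--   [2^{n+1}:2k] = [2^n:k],  [2^{n+1}:2k+1] = [2^n:k] + [2^n:k+1].
-- (Values outside 0 ≤ m ≤ 2^n are irrelevant junk.)

stern : ℕ → ℕ → ℕ
stern zero m = if m ≡ᵇ 1 then 1 else 0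
stern (suc n) m =
  if m % 2 ≡ᵇ 0 then stern n (m / 2)
                else stern n (m / 2) + stern n (m / 2 + 1)

-- Infinite designs  d₁ d₂ ⋯  are functions  D : ℕ → Bool  with  d_{i+1} = D i.

NotEventuallyConstant : (ℕ → Bool) → Set
NotEventuallyConstant D = ∀ N → ∃ λ i → ∃ λ j → (N ℕ.≤ i) × (N ℕ.≤ j) × (D i ≢ D j)

PurelyPeriodic : (ℕ → Bool) → Set
PurelyPeriodic D = ∃ λ k → (0 ℕ.< k) × (∀ i → D (k + i) ≡ D i)

bit : Bool → ℕ
bit true = 1
bit false = 0

-- trunc D n = m  with  m / 2^n = Σ_{i ≤ n} d_i 2^{-i}, i.e. m = ⌊2^n θ_D⌋.
trunc : (ℕ → Bool) → ℕ → ℕ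
trunc D zero = 0
trunc D (suc n) = 2 * trunc D n + bit (D n)

-- Real quadratic irrationals  ω = (p + q √d) / r  with d a non-square,
-- q ≠ 0 and r > 0 (every real quadratic irrational has such a form).
-- Its algebraic conjugate is  ω' = (p - q √d) / r.

NonSquare : ℕ → Set
NonSquare d = ∀ k → k * k ≢ d

-- PosSurd x y d  :⟺  x + y √d > 0   (d ≥ 0)
PosSurd : ℤ → ℤ → ℕ → Set
PosSurd x y d =
  ((+ 0 ℤ.≤ x) × (+ 0 ℤ.≤ y) × ((+ 0 ℤ.< x) ⊎ (+ 0 ℤ.< y)))
  ⊎ ((+ 0 ℤ.< x) × (y ℤ.< + 0) × (y ℤ.* y ℤ.* + d ℤ.< x ℤ.* x))
  ⊎ ((x ℤ.< + 0) × (+ 0 ℤ.< y) × (x ℤ.* x ℤ.< y ℤ.* y ℤ.* + d))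

-- a / b < (p + q √d)/r    (for b > 0, r > 0):  (b p - a r) + (b q) √d > 0
RatBelow : ℕ → ℕ → ℤ → ℤ → ℕ → ℕ → Set
RatBelow a b p q r d = PosSurd (+ b ℤ.* p ℤ.- + a ℤ.* + r) (+ b ℤ.* q) d

-- (p + q √d)/r < a / b    (for b > 0, r > 0):  (a r - b p) - (b q) √d > 0
RatAbove : ℕ → ℕ → ℤ → ℤ → ℕ → ℕ → Set
RatAbove a b p q r d = PosSurd (+ a ℤ.* + r ℤ.- + b ℤ.* p) (- (+ b ℤ.* q)) d

-- The assembly function: A(m/2^n) = [2^n:m]/[2^n:2^n-m], extended to the
-- unique continuous strictly increasing bijection [0,1) → [0,∞).
-- For a design D (not eventually constant) θ_D lies strictly between the
-- dyadic numbers m/2^n and (m+1)/2^n, m = trunc D n, for every n, and these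
-- intervals shrink to θ_D; hence, A being continuous and strictly increasing,
-- A(θ_D) = ω  iff  for every n
--   A(m/2^n) < ω < A((m+1)/2^n)
-- (the upper bound being +∞, i.e. vacuous, when m+1 = 2^n, where the
-- denominator [2^n:0] vanishes).

AssemblesTo : (ℕ → Bool) → ℤ → ℤ → ℕ → ℕ → Set
AssemblesTo D p q r d = ∀ n →
  RatBelow (stern n (trunc D n)) (stern n (2 ^ n ∸ trunc D n)) p q r d
  × ((stern n (2 ^ n ∸ suc (trunc D n)) ≡ 0)
     ⊎ RatAbove (stern n (suc (trunc D n))) (stern n (2 ^ n ∸ suc (trunc D n))) p q r d)

IsPure : ℤ → ℤ → ℕ → ℕ → Set
IsPure p q r d = ∃ λ (D : ℕ → Bool) →
  NotEventuallyConstant D × PurelyPeriodic D × AssemblesTo D p q r d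

IsNonPure : ℤ → ℤ → ℕ → ℕ → Set
IsNonPure p q r d = ¬ IsPure p q r d

{-# OPTIONS --safe #-}

-- If a/b < ω < a′/b′ are the bounds given by the first n digits of a design of ω, then
-- passing to n + 1 digits replaces one of the two bounds by the mediant
-- (a + a′)/(b + b′).  For the pair u = bω − a, v = a′ − b′ω this is the subtractive
-- Euclidean algorithm: digit 1 replaces u by u − v, digit 0 replaces v by v − u, and the
-- digits are those of ω iff u and v stay positive.  The binary quadratic form
-- (N v, tr(u v̄)/2, N u) evolves by invertible integral maps of constant discriminant,
-- and only finitely many forms with N u · N v < 0 share a discriminant.
--
-- If ω′ < 0, then ū < 0 < v̄ persists.  Hence the next digit and also the preceding one
-- can be read off the form, and pigeonhole makes the sequence of forms purely periodic.
-- If ω′ > 0, then as long as ū and v̄ are both positive the positive integer tr(u v̄)/2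
-- strictly decreases, so eventually and from then on N u · N v < 0.  Were the design
-- purely periodic, two forms at multiples of its period would coincide, and running the
-- steps backwards would give N u · N v < 0 already at the start.

module Submission where

open import Defs
open import Data.Nat using (ℕ; _<_)
open import Data.Integer using (ℤ; +_; -_)
open import Data.Product using (_×_)
open import Function.Bundles using (_⇔_)
open import Relation.Binary.PropositionalEquality using (_≢_)

open import Data.Bool using (Bool; true; false)
open import Data.Empty using (⊥-elim)
open import Data.Fin using (Fin; toℕ; fromℕ<; combine)
import Data.Fin as Fin
open import Data.Fin.Properties using (pigeonhole; combine-injective; fromℕ<-injective)
open import Data.Integer using (_+_; _*_; _-_; -[1+_]; ∣_∣)
import Data.Integer as ℤ
import Data.Integer.Properties as ℤₚ
open import Data.Integer.Tactic.RingSolver using (solve-∀)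
open import Data.Nat using (zero; suc; z<s; _∸_; _^_)
import Data.Nat as ℕ
open import Data.Nat.Coprimality using (coprime-/gcd; coprime-divisor; Coprime)
import Data.Nat.Coprimality as Coprimality
open import Data.Nat.Divisibility using (_∣_; divides; ∣-refl; n∣m*n)
open import Data.Nat.DivMod using (m/n*n≡m; m*n%n≡0; m*n/n≡m; [m+kn]%n≡m%n; +-distrib-/-∣ʳ)
open import Data.Nat.GCD using (gcd; gcd[m,n]∣m; gcd[m,n]∣n; gcd[m,n]≢0)
import Data.Nat.Properties as ℕₚ
import Data.Nat.Tactic.RingSolver as ℕRing
open import Data.Product using (_,_; ∃; proj₁; proj₂)
open import Data.Sum using (_⊎_; inj₁; inj₂; [_,_]′; reduce)
open import Function.Base using (_∘_; _$_)
open import Function.Bundles using (mk⇔)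
open import Relation.Binary.PropositionalEquality using (_≡_; refl; sym; trans; cong; cong₂; subst; subst₂; module ≡-Reasoning)
open import Relation.Nullary using (¬_)

-- Signs of integers and the irrationality of √d

infix 4 0<_

0<_ : ℤ → Set
0< x = + 0 ℤ.< x

sign-trichotomy : ∀ x → 0< x ⊎ x ≡ + 0 ⊎ 0< - x
sign-trichotomy (+ zero)  = inj₂ (inj₁ refl)
sign-trichotomy (+ suc n) = inj₁ (ℤ.+<+ z<s)
sign-trichotomy -[1+ n ]  = inj₂ (inj₂ (ℤ.+<+ z<s))

pos-asym : ∀ x → 0< x → ¬ 0< - x
pos-asym (+ suc n) _ ()
pos-asym (+ zero) (ℤ.+<+ ())

pos-+ : ∀ {x y} → 0< x → 0< y → 0< x + y
pos-+ = ℤₚ.+-mono-<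

pos-+-nonneg : ∀ {x y} → 0< x → + 0 ℤ.≤ y → 0< x + y
pos-+-nonneg = ℤₚ.+-mono-<-≤

pos-* : ∀ {x y} → 0< x → 0< y → 0< x * y
pos-* {+ suc m} {+ suc n} _ _ = ℤ.+<+ z<s
pos-* {+ zero} (ℤ.+<+ ())
pos-* {+ suc _} {+ zero} _ (ℤ.+<+ ())

square-nonneg : ∀ x → + 0 ℤ.≤ x * x
square-nonneg (+ zero)  = ℤ.+≤+ ℕ.z≤n
square-nonneg (+ suc n) = ℤ.+≤+ ℕ.z≤n
square-nonneg -[1+ n ]  = ℤ.+≤+ ℕ.z≤n

nonneg-* : ∀ {x y} → + 0 ℤ.≤ x → + 0 ℤ.≤ y → + 0 ℤ.≤ x * y
nonneg-* {+ m} {+ n} _ _ = subst (+ 0 ℤ.≤_) (ℤₚ.pos-* m n) (ℤ.+≤+ ℕ.z≤n)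

<⇒0<∸ : ∀ {x y} → x ℤ.< y → 0< y - x
<⇒0<∸ {x} {y} x<y = subst (ℤ._< y - x) (ℤₚ.+-inverseʳ x) (ℤₚ.+-monoˡ-< (- x) x<y)

0<∸⇒< : ∀ {x y} → 0< y - x → x ℤ.< y
0<∸⇒< {x} {y} p = subst₂ ℤ._<_ (ℤₚ.+-identityʳ x) (eq x y) (ℤₚ.+-monoʳ-< x p)
  where
  eq : ∀ x y → x + (y - x) ≡ y
  eq = solve-∀

-- Otherwise y - x > 0 and y + x > 0, whence y² > x².
pos-of-squares : ∀ x y → 0< x → 0< x * x - y * y → 0< x - y
pos-of-squares x y 0<x h with sign-trichotomy (x - y)
... | inj₁ 0<x-y = 0<x-y
... | inj₂ (inj₁ x-y≡0) = ⊥-elim (ℤₚ.<-irrefl refl (subst 0<_ (trans (eq x y) (cong (_* (x + y)) x-y≡0)) h))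
  where
  eq : ∀ x y → x * x - y * y ≡ (x - y) * (x + y)
  eq = solve-∀
... | inj₂ (inj₂ 0<y-x) = ⊥-elim (pos-asym _ h (subst 0<_ (eq₂ x y) (pos-* 0<y-x 0<y+x)))
  where
  eq₁ : ∀ x y → - (x - y) + (x + x) ≡ y + x
  eq₁ = solve-∀
  eq₂ : ∀ x y → - (x - y) * (y + x) ≡ - (x * x - y * y)
  eq₂ = solve-∀
  0<y+x : 0< y + x
  0<y+x = subst 0<_ (eq₁ x y) (pos-+ 0<y-x (pos-+ 0<x 0<x))

-- Dividing by `g = gcd a b` gives a′² = d b′² with a′ and b′ coprime. Then b′ divides a′², hence
-- a′, so b′ = 1 and d would be the square of a′.
nonSquare-irrational : ∀ {d} → NonSquare d → ∀ a b → a ℕ.* a ≡ d ℕ.* (b ℕ.* b) → b ≡ 0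
nonSquare-irrational ns a zero _ = refl
nonSquare-irrational {d} ns a b@(suc _) aa≡dbb =
  ⊥-elim (ns a′ (trans a′a′≡db′b′ (trans (cong (λ k → d ℕ.* (k ℕ.* k)) b′≡1) (ℕₚ.*-identityʳ d))))
  where
  g = gcd a b
  instance
    g≢0 : ℕ.NonZero g
    g≢0 = ℕ.≢-nonZero (gcd[m,n]≢0 a b (inj₂ λ ()))
  a′ = a ℕ./ g
  b′ = b ℕ./ g
  instance
    gg≢0 : ℕ.NonZero (g ℕ.* g)
    gg≢0 = ℕₚ.m*n≢0 g g
  eqˡ : ∀ x g → x ℕ.* x ℕ.* (g ℕ.* g) ≡ x ℕ.* g ℕ.* (x ℕ.* g)
  eqˡ = ℕRing.solve-∀
  eqʳ : ∀ d y g → d ℕ.* (y ℕ.* g ℕ.* (y ℕ.* g)) ≡ d ℕ.* (y ℕ.* y) ℕ.* (g ℕ.* g)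
  eqʳ = ℕRing.solve-∀
  a′g≡a : a′ ℕ.* g ≡ a
  a′g≡a = m/n*n≡m (gcd[m,n]∣m a b)
  b′g≡b : b′ ℕ.* g ≡ b
  b′g≡b = m/n*n≡m (gcd[m,n]∣n a b)
  a′a′≡db′b′ : a′ ℕ.* a′ ≡ d ℕ.* (b′ ℕ.* b′)
  a′a′≡db′b′ = ℕₚ.*-cancelʳ-≡ _ _ (g ℕ.* g) $ begin
    a′ ℕ.* a′ ℕ.* (g ℕ.* g)              ≡⟨ eqˡ a′ g ⟩
    a′ ℕ.* g ℕ.* (a′ ℕ.* g)              ≡⟨ cong (λ k → k ℕ.* k) a′g≡a ⟩
    a ℕ.* a                              ≡⟨ aa≡dbb ⟩
    d ℕ.* (b ℕ.* b)                      ≡⟨ cong (λ k → d ℕ.* (k ℕ.* k)) b′g≡b ⟨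
    d ℕ.* (b′ ℕ.* g ℕ.* (b′ ℕ.* g))      ≡⟨ eqʳ d b′ g ⟩
    d ℕ.* (b′ ℕ.* b′) ℕ.* (g ℕ.* g)      ∎
    where open ≡-Reasoning
  coprime : Coprime a′ b′
  coprime = coprime-/gcd a b
  b′∣a′a′ : b′ ∣ a′ ℕ.* a′
  b′∣a′a′ = divides (d ℕ.* b′) (trans a′a′≡db′b′ (sym (ℕₚ.*-assoc d b′ b′)))
  b′≡1 : b′ ≡ 1
  b′≡1 = coprime (coprime-divisor (Coprimality.sym coprime) b′∣a′a′ , ∣-refl)

nonSquare-pos : ∀ {d} → NonSquare d → 0< + d
nonSquare-pos {zero}  ns = ⊥-elim (ns 0 refl)
nonSquare-pos {suc _} _  = ℤ.+<+ z<s

-- Surds x + y√d, their norm and their positivity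

Surd : Set
Surd = ℤ × ℤ

infixl 6 _⊕_ _⊝_

_⊕_ _⊝_ : Surd → Surd → Surd
(x , y) ⊕ (x′ , y′) = x + x′ , y + y′
(x , y) ⊝ (x′ , y′) = x - x′ , y - y′

⊝-⊕ : ∀ u v → (u ⊝ v) ⊕ v ≡ u
⊝-⊕ (x , y) (x′ , y′) = cong₂ _,_ (eq x x′) (eq y y′)
  where
  eq : ∀ x x′ → x - x′ + x′ ≡ x
  eq = solve-∀

module Quadratic (d : ℕ) (ns : NonSquare d) where

  δ : ℤ
  δ = + d

  0<δ : 0< δ
  0<δ = nonSquare-pos ns

  norm : Surd → ℤ
  norm (x , y) = x * x - y * y * δ

  -- The rational part of u v̄, that is tr(u v̄)/2: the bilinear form polar to `norm`.
  polar : Surd → Surd → ℤ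
  polar (x , y) (x′ , y′) = x * x′ - y * y′ * δ

  polar-comm : ∀ u v → polar u v ≡ polar v u
  polar-comm (x , y) (x′ , y′) = eq x y x′ y′ δ
    where
    eq : ∀ x y x′ y′ δ → x * x′ - y * y′ * δ ≡ x′ * x - y′ * y * δ
    eq = solve-∀

  norm-⊕ : ∀ u v → norm (u ⊕ v) ≡ norm u + norm v + (polar u v + polar u v)
  norm-⊕ (x , y) (x′ , y′) = eq x y x′ y′ δ
    where
    eq : ∀ x y x′ y′ δ → (x + x′) * (x + x′) - (y + y′) * (y + y′) * δ ≡
      (x * x - y * y * δ) + (x′ * x′ - y′ * y′ * δ) + ((x * x′ - y * y′ * δ) + (x * x′ - y * y′ * δ))
    eq = solve-∀

  norm-⊝ : ∀ u v → norm (u ⊝ v) ≡ norm v - (polar u v + polar u v) + norm u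
  norm-⊝ (x , y) (x′ , y′) = eq x y x′ y′ δ
    where
    eq : ∀ x y x′ y′ δ → (x - x′) * (x - x′) - (y - y′) * (y - y′) * δ ≡
      (x′ * x′ - y′ * y′ * δ) - ((x * x′ - y * y′ * δ) + (x * x′ - y * y′ * δ)) + (x * x - y * y * δ)
    eq = solve-∀

  polar-⊝ˡ : ∀ u v → polar (u ⊝ v) v ≡ polar u v - norm v
  polar-⊝ˡ (x , y) (x′ , y′) = eq x y x′ y′ δ
    where
    eq : ∀ x y x′ y′ δ → (x - x′) * x′ - (y - y′) * y′ * δ ≡
      (x * x′ - y * y′ * δ) - (x′ * x′ - y′ * y′ * δ)
    eq = solve-∀

  polar-⊝ʳ : ∀ u v → polar u (v ⊝ u) ≡ polar u v - norm u
  polar-⊝ʳ u v = trans (polar-comm u (v ⊝ u)) (trans (polar-⊝ˡ v u) (cong (_- norm u) (polar-comm v u)))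

  norm-⊝-comm : ∀ u v → norm (v ⊝ u) ≡ norm (u ⊝ v)
  norm-⊝-comm (x , y) (x′ , y′) = eq x y x′ y′ δ
    where
    eq : ∀ x y x′ y′ δ → (x′ - x) * (x′ - x) - (y′ - y) * (y′ - y) * δ ≡ (x - x′) * (x - x′) - (y - y′) * (y - y′) * δ
    eq = solve-∀

  norm≡0 : ∀ x y → norm (x , y) ≡ + 0 → x ≡ + 0 × y ≡ + 0
  norm≡0 x y N≡0 = ℤₚ.∣i∣≡0⇒i≡0 ∣x∣≡0 , ℤₚ.∣i∣≡0⇒i≡0 ∣y∣≡0
    where
    ∣x∣²≡d∣y∣² : ∣ x ∣ ℕ.* ∣ x ∣ ≡ d ℕ.* (∣ y ∣ ℕ.* ∣ y ∣)
    ∣x∣²≡d∣y∣² = begin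
      ∣ x ∣ ℕ.* ∣ x ∣          ≡⟨ ℤₚ.abs-* x x ⟨
      ∣ x * x ∣                ≡⟨ cong ∣_∣ (ℤₚ.i-j≡0⇒i≡j (x * x) (y * y * δ) N≡0) ⟩
      ∣ y * y * δ ∣            ≡⟨ ℤₚ.abs-* (y * y) δ ⟩
      ∣ y * y ∣ ℕ.* d          ≡⟨ ℕₚ.*-comm _ d ⟩
      d ℕ.* ∣ y * y ∣          ≡⟨ cong (d ℕ.*_) (ℤₚ.abs-* y y) ⟩
      d ℕ.* (∣ y ∣ ℕ.* ∣ y ∣)  ∎
      where open ≡-Reasoning
    ∣y∣≡0 : ∣ y ∣ ≡ 0
    ∣y∣≡0 = nonSquare-irrational ns ∣ x ∣ ∣ y ∣ ∣x∣²≡d∣y∣²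
    ∣x∣≡0 : ∣ x ∣ ≡ 0
    ∣x∣≡0 = reduce (ℕₚ.m*n≡0⇒m≡0∨n≡0 ∣ x ∣
      (trans ∣x∣²≡d∣y∣² (trans (cong (λ k → d ℕ.* (k ℕ.* k)) ∣y∣≡0) (ℕₚ.*-zeroʳ d))))

  -- Among positive surds, those with positive and with negative conjugate.
  PP PN Pos : Surd → Set
  PP u = 0< proj₁ u × 0< norm u
  PN u = 0< proj₂ u × 0< - norm u
  Pos u = PP u ⊎ PN u

  PP-PN-disjoint : ∀ u → PP u → ¬ PN u
  PP-PN-disjoint u (_ , 0<N) (_ , 0<-N) = pos-asym _ 0<N 0<-N

  -- With ū, v̄ > 0 both terms of u v̄ + ū v are positive. In integers: (x x′)² - (y y′ δ)² = x² N v
  -- + y′² δ N u, so |y y′ δ| < x x′.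
  polar-pos : ∀ u v → PP u → PP v → 0< polar u v
  polar-pos (x , y) (x′ , y′) (0<x , 0<N) (0<x′ , 0<N′) =
    pos-of-squares (x * x′) (y * y′ * δ) (pos-* 0<x 0<x′)
      (subst 0<_ (eq x y x′ y′ δ) (pos-+-nonneg (pos-* (pos-* 0<x 0<x) 0<N′)
        (nonneg-* (nonneg-* (square-nonneg y′) (ℤₚ.<⇒≤ 0<δ)) (ℤₚ.<⇒≤ 0<N))))
    where
    eq : ∀ x y x′ y′ δ → x * x * (x′ * x′ - y′ * y′ * δ) + y′ * y′ * δ * (x * x - y * y * δ) ≡
      x * x′ * (x * x′) - y * y′ * δ * (y * y′ * δ)
    eq = solve-∀

  polar-neg : ∀ u v → PN u → PN v → 0< - polar u v
  polar-neg (x , y) (x′ , y′) (0<y , 0<-N) (0<y′ , 0<-N′) =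
    subst 0<_ (eq₂ x y x′ y′ δ) (pos-of-squares (y * y′ * δ) (x * x′) (pos-* (pos-* 0<y 0<y′) 0<δ)
      (subst 0<_ (eq₁ x y x′ y′ δ) (pos-+-nonneg (pos-* (pos-* (pos-* 0<y′ 0<y′) 0<δ) 0<-N)
        (nonneg-* (square-nonneg x) (ℤₚ.<⇒≤ 0<-N′)))))
    where
    eq₁ : ∀ x y x′ y′ δ → y′ * y′ * δ * - (x * x - y * y * δ) + x * x * - (x′ * x′ - y′ * y′ * δ) ≡
      y * y′ * δ * (y * y′ * δ) - x * x′ * (x * x′)
    eq₁ = solve-∀
    eq₂ : ∀ x y x′ y′ δ → y * y′ * δ - x * x′ ≡ - (x * x′ - y * y′ * δ)
    eq₂ = solve-∀

  PP-⊕ : ∀ u v → PP u → PP v → PP (u ⊕ v)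
  PP-⊕ u v pu@(0<x , 0<N) pv@(0<x′ , 0<N′) =
    pos-+ 0<x 0<x′ ,
    subst 0<_ (sym (norm-⊕ u v)) (pos-+ (pos-+ 0<N 0<N′) (pos-+ 0<t 0<t))
    where
    0<t = polar-pos u v pu pv

  PN-⊕ : ∀ u v → PN u → PN v → PN (u ⊕ v)
  PN-⊕ u v pu@(0<y , 0<-N) pv@(0<y′ , 0<-N′) =
    pos-+ 0<y 0<y′ ,
    subst 0<_ (trans (eq (norm u) (norm v) (polar u v)) (cong -_ (sym (norm-⊕ u v))))
      (pos-+ (pos-+ 0<-N 0<-N′) (pos-+ 0<-t 0<-t))
    where
    0<-t = polar-neg u v pu pv
    eq : ∀ a b t → - a + - b + (- t + - t) ≡ - (a + b + (t + t))
    eq = solve-∀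

  PP-⊝⇒PP : ∀ u v → PP (u ⊝ v) → PP v → PP u
  PP-⊝⇒PP u v pw pv = subst PP (⊝-⊕ u v) (PP-⊕ (u ⊝ v) v pw pv)

  PN-⊝⇒PN : ∀ u v → PN (u ⊝ v) → PN v → PN u
  PN-⊝⇒PN u v pw pv = subst PN (⊝-⊕ u v) (PN-⊕ (u ⊝ v) v pw pv)

  0<norm⇒x≢0 : ∀ x y → x ≡ + 0 → ¬ 0< norm (x , y)
  0<norm⇒x≢0 x y refl h = ℤₚ.<⇒≱ (subst 0<_ (eq y δ) h) (ℤₚ.neg-mono-≤ (nonneg-* (square-nonneg y) (ℤₚ.<⇒≤ 0<δ)))
    where
    eq : ∀ y δ → + 0 * + 0 - y * y * δ ≡ - (y * y * δ)
    eq = solve-∀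

  norm<0⇒y≢0 : ∀ x y → y ≡ + 0 → ¬ 0< - norm (x , y)
  norm<0⇒y≢0 x y refl h = ℤₚ.<⇒≱ (subst 0<_ (eq x δ) h) (ℤₚ.neg-mono-≤ (square-nonneg x))
    where
    eq : ∀ x δ → - (x * x - + 0 * + 0 * δ) ≡ - (x * x)
    eq = solve-∀

  -- Two non-negative coordinates allow either sign of the conjugate, and the sign of the norm
  -- decides; a zero norm would make both coordinates vanish.
  PosSurd⇒Pos : ∀ x y → PosSurd x y d → Pos (x , y)
  PosSurd⇒Pos x y (inj₁ (0≤x , 0≤y , h)) with sign-trichotomy (norm (x , y))
  ... | inj₁ 0<N = inj₁ (ℤₚ.≤∧≢⇒< 0≤x (λ 0≡x → 0<norm⇒x≢0 x y (sym 0≡x) 0<N) , 0<N)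
  ... | inj₂ (inj₂ 0<-N) = inj₂ (ℤₚ.≤∧≢⇒< 0≤y (λ 0≡y → norm<0⇒y≢0 x y (sym 0≡y) 0<-N) , 0<-N)
  ... | inj₂ (inj₁ N≡0) with norm≡0 x y N≡0
  ...   | refl , refl = ⊥-elim ([ ℤₚ.<-irrefl refl , ℤₚ.<-irrefl refl ]′ h)
  PosSurd⇒Pos x y (inj₂ (inj₁ (0<x , _ , h))) = inj₁ (0<x , <⇒0<∸ h)
  PosSurd⇒Pos x y (inj₂ (inj₂ (_ , 0<y , h))) = inj₂ (0<y , subst 0<_ (eq x y δ) (<⇒0<∸ h))
    where
    eq : ∀ x y δ → y * y * δ - x * x ≡ - (x * x - y * y * δ)
    eq = solve-∀

  Pos⇒PosSurd : ∀ x y → Pos (x , y) → PosSurd x y d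
  Pos⇒PosSurd x (+ n) (inj₁ (0<x , _)) = inj₁ (ℤₚ.<⇒≤ 0<x , ℤ.+≤+ ℕ.z≤n , inj₁ 0<x)
  Pos⇒PosSurd x y@(-[1+ n ]) (inj₁ (0<x , 0<N)) = inj₂ (inj₁ (0<x , ℤ.-<+ , 0<∸⇒< 0<N))
  Pos⇒PosSurd (+ n) y (inj₂ (0<y , _)) = inj₁ (ℤ.+≤+ ℕ.z≤n , ℤₚ.<⇒≤ 0<y , inj₂ 0<y)
  Pos⇒PosSurd x@(-[1+ n ]) y (inj₂ (0<y , 0<-N)) = inj₂ (inj₂ (ℤ.-<+ , 0<y , 0<∸⇒< (subst 0<_ (eq x y δ) 0<-N)))
    where
    eq : ∀ x y δ → - (x * x - y * y * δ) ≡ y * y * δ - x * x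
    eq = solve-∀

  -- As ū - v̄ < 0, the sign of N(u - v) is opposite to that of u - v. So the sign of an integer
  -- tells which of u and v is larger, and the positive difference keeps the conjugate sign of its
  -- minuend.
  PN-PP-⊝ : ∀ u v → PN u → PP v → PN (u ⊝ v) × 0< - norm (u ⊝ v) ⊎ PP (v ⊝ u) × 0< norm (u ⊝ v)
  PN-PP-⊝ u@(x , y) v@(x′ , y′) pu pv with sign-trichotomy (norm (u ⊝ v))
  ... | inj₂ (inj₁ N≡0) with norm≡0 _ _ N≡0
  ...   | x≡ , y≡ with ℤₚ.i-j≡0⇒i≡j x x′ x≡ | ℤₚ.i-j≡0⇒i≡j y y′ y≡
  ...     | refl | refl = ⊥-elim (PP-PN-disjoint u pv pu)
  PN-PP-⊝ u@(x , y) v@(x′ , y′) pu pv | inj₁ 0<N with sign-trichotomy (x - x′)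
  -- Were u - v in `PP`, its sum with v, which is u, would be there too.
  ... | inj₁ 0<w = ⊥-elim (PP-PN-disjoint u (PP-⊝⇒PP u v (0<w , 0<N) pv) pu)
  ... | inj₂ (inj₁ w≡0) = ⊥-elim (0<norm⇒x≢0 _ (y - y′) w≡0 0<N)
  ... | inj₂ (inj₂ 0<-w) = inj₂ ((subst 0<_ (eq x x′) 0<-w , subst 0<_ (sym (norm-⊝-comm u v)) 0<N) , 0<N)
    where
    eq : ∀ x x′ → - (x - x′) ≡ x′ - x
    eq = solve-∀
  PN-PP-⊝ u@(x , y) v@(x′ , y′) pu pv | inj₂ (inj₂ 0<-N) with sign-trichotomy (y - y′)
  ... | inj₁ 0<w = inj₁ ((0<w , 0<-N) , 0<-N)
  ... | inj₂ (inj₁ w≡0) = ⊥-elim (norm<0⇒y≢0 (x - x′) _ w≡0 0<-N)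
  ... | inj₂ (inj₂ 0<-w) = ⊥-elim (PP-PN-disjoint v pv (PN-⊝⇒PN v u
          (subst 0<_ (eq y y′) 0<-w , subst (λ n → 0< - n) (sym (norm-⊝-comm u v)) 0<-N) pu))
    where
    eq : ∀ x x′ → - (x - x′) ≡ x′ - x
    eq = solve-∀

-- Binary quadratic forms and their integral steps

-- (a , t , c) stands for the form a X² − 2 t X Y + c Y².
Form : Set
Form = ℤ × ℤ × ℤ

-- The substitutions X ↦ X + Y (digit 1) and Y ↦ X + Y (digit 0). Both are unimodular, whence the
-- inverse `unstep` and the invariance of `disc`.
step : Bool → Form → Form
step true  (a , t , c) = a , t - a , a - (t + t) + c
step false (a , t , c) = a - (t + t) + c , t - c , c

unstep : Bool → Form → Form
unstep true  (a , t , c) = a , t + a , a + (t + t) + c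
unstep false (a , t , c) = a + (t + t) + c , t + c , c

,,-cong : ∀ {a a′ t t′ c c′ : ℤ} → a ≡ a′ → t ≡ t′ → c ≡ c′ → (a , t , c) ≡ (a′ , t′ , c′)
,,-cong refl refl refl = refl

cancel : ∀ a t → t - a + a ≡ t
cancel = solve-∀

outer-true : ∀ a t c → a + (t - a + (t - a)) + (a - (t + t) + c) ≡ c
outer-true = solve-∀

outer-false : ∀ a t c → a - (t + t) + c + (t - c + (t - c)) + c ≡ a
outer-false = solve-∀

unstep-step : ∀ b f → unstep b (step b f) ≡ f
unstep-step true  (a , t , c) = cong₂ (λ t c → a , t , c) (cancel a t) (outer-true a t c)
unstep-step false (a , t , c) = cong₂ (λ a t → a , t , c) (outer-false a t c) (cancel c t)

-- A quarter of the usual discriminant, the middle coefficient being -2t.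
disc : Form → ℤ
disc (a , t , c) = t * t - a * c

disc-step : ∀ b f → disc (step b f) ≡ disc f
disc-step true (a , t , c) = eq a t c
  where
  eq : ∀ a t c → (t - a) * (t - a) - a * (a - (t + t) + c) ≡ t * t - a * c
  eq = solve-∀
disc-step false (a , t , c) = eq a t c
  where
  eq : ∀ a t c → (t - c) * (t - c) - (a - (t + t) + c) * c ≡ t * t - a * c
  eq = solve-∀

-- Finitely many forms with a c < 0 share a discriminant

Indefinite : Form → Set
Indefinite (a , _ , c) = 0< - (a * c)

Bounded : ℕ → Form → Set
Bounded B (a , t , c) = ∣ a ∣ ℕ.≤ B × ∣ t ∣ ℕ.≤ B × ∣ c ∣ ℕ.≤ B

nonneg-abs-+ : ∀ {i j} → + 0 ℤ.≤ i → + 0 ℤ.≤ j → ∣ i + j ∣ ≡ ∣ i ∣ ℕ.+ ∣ j ∣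
nonneg-abs-+ (ℤ.+≤+ _) (ℤ.+≤+ _) = refl

m≤m*m : ∀ m → m ℕ.≤ m ℕ.* m
m≤m*m zero    = ℕ.z≤n
m≤m*m m@(suc _) = ℕₚ.m≤m*n m m

-- The discriminant is t² + (-a c), a sum of non-negative terms, so it bounds t² and |a||c|. Neither
-- a nor c vanishes, so it bounds |a| and |c| as well.
indefinite-bounded : ∀ f → Indefinite f → Bounded ∣ disc f ∣ f
indefinite-bounded f@(a , t , c) ind =
  ℕₚ.≤-trans (ℕₚ.m≤m*n ∣ a ∣ ∣ c ∣ {{c≢0}}) ac≤disc ,
  ℕₚ.≤-trans (ℕₚ.≤-trans (m≤m*m ∣ t ∣) (ℕₚ.m≤m+n _ _)) (ℕₚ.≤-reflexive (sym disc≡)) ,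
  ℕₚ.≤-trans (ℕₚ.m≤n*m ∣ c ∣ ∣ a ∣ {{a≢0}}) ac≤disc
  where
  disc≡ : ∣ disc f ∣ ≡ ∣ t ∣ ℕ.* ∣ t ∣ ℕ.+ ∣ a ∣ ℕ.* ∣ c ∣
  disc≡ = trans (nonneg-abs-+ (square-nonneg t) (ℤₚ.<⇒≤ ind))
    (cong₂ ℕ._+_ (ℤₚ.abs-* t t) (trans (ℤₚ.∣-i∣≡∣i∣ (a * c)) (ℤₚ.abs-* a c)))
  ac≤disc : ∣ a ∣ ℕ.* ∣ c ∣ ℕ.≤ ∣ disc f ∣
  ac≤disc = ℕₚ.≤-trans (ℕₚ.m≤n+m _ _) (ℕₚ.≤-reflexive (sym disc≡))
  a≢0 : ℕ.NonZero ∣ a ∣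
  a≢0 = ℕ.≢-nonZero λ ∣a∣≡0 → ℤₚ.<-irrefl refl
    (subst (λ x → 0< - (x * c)) (ℤₚ.∣i∣≡0⇒i≡0 {a} ∣a∣≡0) ind)
  c≢0 : ℕ.NonZero ∣ c ∣
  c≢0 = ℕ.≢-nonZero λ ∣c∣≡0 → ℤₚ.<-irrefl (sym (cong -_ (ℤₚ.*-zeroʳ a)))
    (subst (λ x → 0< - (a * x)) (ℤₚ.∣i∣≡0⇒i≡0 {c} ∣c∣≡0) ind)

signCode : ℤ → Fin 2
signCode (+ _)    = Fin.zero
signCode -[1+ _ ] = Fin.suc Fin.zero

signCode-abs-injective : ∀ x y → signCode x ≡ signCode y → ∣ x ∣ ≡ ∣ y ∣ → x ≡ y
signCode-abs-injective (+ _)    (+ _)    _ refl = refl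
signCode-abs-injective -[1+ _ ] -[1+ _ ] _ refl = refl
signCode-abs-injective (+ _)    -[1+ _ ] () _
signCode-abs-injective -[1+ _ ] (+ _)    () _

-- Abstract because unfolding Fin (2 * suc B) makes the later type checking very slow.
abstract
  width : ℕ → ℕ
  width B = 2 ℕ.* suc B

  code : ∀ {B} x → ∣ x ∣ ℕ.≤ B → Fin (width B)
  code x x≤B = combine (signCode x) (fromℕ< (ℕ.s≤s x≤B))

  code-injective : ∀ {B} x y (x≤B : ∣ x ∣ ℕ.≤ B) (y≤B : ∣ y ∣ ℕ.≤ B) → code x x≤B ≡ code y y≤B → x ≡ y
  code-injective x y x≤B y≤B eq with combine-injective (signCode x) _ (signCode y) _ eq
  ... | eq₁ , eq₂ = signCode-abs-injective x y eq₁ (fromℕ<-injective _ _ (ℕ.s≤s x≤B) (ℕ.s≤s y≤B) eq₂)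

codes : ℕ → ℕ
codes B = width B ℕ.* (width B ℕ.* width B)

formCode : ∀ {B} f → Bounded B f → Fin (codes B)
formCode (a , t , c) (a≤ , t≤ , c≤) = combine (code a a≤) (combine (code t t≤) (code c c≤))

formCode-injective : ∀ {B} f g (f≤ : Bounded B f) (g≤ : Bounded B g) → formCode f f≤ ≡ formCode g g≤ → f ≡ g
formCode-injective (a , t , c) (a′ , t′ , c′) (a≤ , t≤ , c≤) (a′≤ , t′≤ , c′≤) eq
  with combine-injective (code a a≤) _ (code a′ a′≤) _ eq
... | eq₁ , eq₂₃ with combine-injective (code t t≤) (code c c≤) (code t′ t′≤) (code c′ c′≤) eq₂₃
...   | eq₂ , eq₃ =
  ,,-cong (code-injective a a′ a≤ a′≤ eq₁) (code-injective t t′ t≤ t′≤ eq₂) (code-injective c c′ c≤ c′≤ eq₃)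

-- Pigeonhole on the finitely many codes of bounded forms; the gap `suc e` is positive by
-- construction.
indefinite-repeats : (G : ℕ → Form) (Δ : ℤ) → (∀ n → disc (G n) ≡ Δ) → (∀ n → Indefinite (G n)) →
  ∃ λ i → ∃ λ e → G i ≡ G (suc e ℕ.+ i)
indefinite-repeats G Δ discs inds =
  let i , j , i<j , eq = pigeonhole (ℕₚ.n<1+n (codes ∣ Δ ∣)) (λ i → formCode (G (toℕ i)) (bounded (toℕ i)))
      e , i+e≡j = ℕₚ.m≤n⇒∃[o]m+o≡n i<j
  in toℕ i , e ,
     trans (formCode-injective (G (toℕ i)) (G (toℕ j)) (bounded (toℕ i)) (bounded (toℕ j)) eq)
       (cong G (trans (sym i+e≡j) (cong suc (ℕₚ.+-comm (toℕ i) e))))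
  where
  bounded : ∀ n → Bounded ∣ Δ ∣ (G n)
  bounded n = subst (λ δ → Bounded ∣ δ ∣ (G n)) (discs n) (indefinite-bounded (G n) (inds n))

-- Running the steps along a digit sequence

run : (ℕ → Bool) → Form → ℕ → Form
run D f zero    = f
run D f (suc n) = step (D n) (run D f n)

disc-run : ∀ D f n → disc (run D f n) ≡ disc f
disc-run D f zero    = refl
disc-run D f (suc n) = trans (disc-step (D n) (run D f n)) (disc-run D f n)

run-injective : ∀ D f g n → run D f n ≡ run D g n → f ≡ g
run-injective D f g zero    eq = eq
run-injective D f g (suc n) eq = run-injective D f g n
  (trans (sym (unstep-step (D n) _)) (trans (cong (unstep (D n)) eq) (unstep-step (D n) _)))

Period : (ℕ → Bool) → ℕ → Set
Period D k = ∀ i → D (k ℕ.+ i) ≡ D i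

period-multiple : ∀ {D k} → Period D k → ∀ j → Period D (j ℕ.* k)
period-multiple per zero    i = refl
period-multiple {D} {k} per (suc j) i =
  trans (cong D (ℕₚ.+-assoc k (j ℕ.* k) i)) (trans (per _) (period-multiple per j i))

-- The digits from position k on are again D, so they act on `run D f k` as D acts on f.
run-period : ∀ {D k} → Period D k → ∀ f n → run D f (k ℕ.+ n) ≡ run D (run D f k) n
run-period {D} {k} per f zero = cong (run D f) (ℕₚ.+-identityʳ k)
run-period {D} {k} per f (suc n) = trans (cong (run D f) (ℕₚ.+-suc k n)) (cong₂ step (per n) (run-period per f n))

run-fixed : ∀ {D k f} → Period D k → run D f k ≡ f → ∀ j → run D f (j ℕ.* k) ≡ f
run-fixed per fix zero = refl
run-fixed {D} {k} {f} per fix (suc j) =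
  trans (run-period per f (j ℕ.* k)) (trans (cong (λ g → run D g (j ℕ.* k)) fix) (run-fixed per fix j))

-- The same n digits take f and `run D f k` to the same form, and invertible steps can be undone.
run-returns : ∀ {D k f} → Period D k → ∀ n → run D f n ≡ run D f (k ℕ.+ n) → run D f k ≡ f
run-returns {D} {k} {f} per n eq = run-injective D (run D f k) f n (sym (trans eq (run-period per f n)))

-- The steps being invertible, a repetition among the forms at multiples of the
-- period propagates back to the initial form.
period-eventually-indefinite : ∀ {D k f} → 0 < k → Period D k →
  ∀ N → (∀ n → N ℕ.≤ n → Indefinite (run D f n)) → Indefinite f
period-eventually-indefinite {D} {k} {f} 0<k per N ind = returns repeats
  where
  instance
    k≢0 : ℕ.NonZero k
    k≢0 = ℕ.>-nonZero 0<k
  index : ℕ → ℕ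
  -- Multiples of k starting at N k; all are at least N because k > 0, so every sampled form is
  -- indefinite.
  index n = (n ℕ.+ N) ℕ.* k
  repeats : ∃ λ i → ∃ λ e → run D f (index i) ≡ run D f (index (suc e ℕ.+ i))
  repeats = indefinite-repeats (λ n → run D f (index n)) (disc f) (λ n → disc-run D f (index n))
    (λ n → ind (index n) (ℕₚ.≤-trans (ℕₚ.m≤n+m N n) (ℕₚ.m≤m*n (n ℕ.+ N) k)))
  index-+ : ∀ e i → index (suc e ℕ.+ i) ≡ suc e ℕ.* k ℕ.+ index i
  index-+ e i = trans (cong (ℕ._* k) (ℕₚ.+-assoc (suc e) i N)) (ℕₚ.*-distribʳ-+ k (suc e) (i ℕ.+ N))
  returns : (∃ λ i → ∃ λ e → run D f (index i) ≡ run D f (index (suc e ℕ.+ i))) → Indefinite f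
  -- f recurs at every multiple of L = (e + 1) k, in particular at N L ≥ N, where the form is known
  -- to be indefinite.
  returns (i , e , eq) = subst Indefinite (run-fixed perL fixed N)
      (ind (N ℕ.* (suc e ℕ.* k)) (ℕₚ.m≤m*n N (suc e ℕ.* k) {{ℕₚ.m*n≢0 (suc e) k}}))
    where
    perL : Period D (suc e ℕ.* k)
    perL = period-multiple per (suc e)
    fixed : run D f (suc e ℕ.* k) ≡ f
    fixed = run-returns perL (index i) (trans eq (cong (run D f) (index-+ e i)))

-- Greedy digits and reduced forms

isNegative : ℤ → Bool
isNegative (+ _)    = false
isNegative -[1+ _ ] = true

isNegative-pos : ∀ {x} → 0< x → isNegative x ≡ false
isNegative-pos {+ _} _ = refl

isNegative-neg : ∀ {x} → 0< - x → isNegative x ≡ true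
isNegative-neg { -[1+ _ ]} _ = refl
isNegative-neg {+ zero} (ℤ.+<+ ())
isNegative-neg {+ suc _} ()

-- For the form of positive u, v with ū < 0 < v̄, the number tested is N(u - v), negative exactly
-- when u > v.
digit : Form → Bool
digit (a , t , c) = isNegative (a - (t + t) + c)

advance : Form → Form
advance f = step (digit f) f

retreat : Form → Form
retreat f@(a , t , c) = unstep (isNegative (a + (t + t) + c)) f

Reduced : Form → Set
Reduced (a , _ , c) = 0< a × 0< - c

reduced⇒indefinite : ∀ f → Reduced f → Indefinite f
reduced⇒indefinite (a , t , c) (0<a , 0<-c) = subst 0<_ (sym (ℤₚ.neg-distribʳ-* a c)) (pos-* 0<a 0<-c)

-- After a step, `retreat` tests N(u + v). This is the old c after digit 1 and the old a after digit
-- 0; in a reduced form these have opposite signs, so the sign reveals the last digit.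
retreat-advance : ∀ f → Reduced f → retreat (advance f) ≡ f
retreat-advance f@(a , t , c) (0<a , 0<-c) with digit f
... | true = trans (cong (λ b → unstep b (step true f))
        (trans (cong isNegative (outer-true a t c)) (isNegative-neg 0<-c))) (unstep-step true f)
... | false = trans (cong (λ b → unstep b (step false f))
        (trans (cong isNegative (outer-false a t c)) (isNegative-pos 0<a))) (unstep-step false f)

greedy : Form → ℕ → Form
greedy f zero    = f
greedy f (suc n) = advance (greedy f n)

design : Form → ℕ → Bool
design f n = digit (greedy f n)

run-design : ∀ f n → run (design f) f n ≡ greedy f n
run-design f zero    = refl
run-design f (suc n) = cong (step (design f n)) (run-design f n)

-- Retreating i times on both sides moves a repetition back to the start, so there is no preperiod.
greedy-cancel : ∀ f → (∀ n → Reduced (greedy f n)) → ∀ i e → greedy f i ≡ greedy f (i ℕ.+ e) → f ≡ greedy f e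
greedy-cancel f red zero    e eq = eq
greedy-cancel f red (suc i) e eq = greedy-cancel f red i e
  (trans (sym (retreat-advance (greedy f i) (red i)))
    (trans (cong retreat eq) (retreat-advance (greedy f (i ℕ.+ e)) (red (i ℕ.+ e)))))

greedy-returns : ∀ f → (∀ n → Reduced (greedy f n)) → ∃ λ e → f ≡ greedy f (suc e)
greedy-returns f red =
  let i , e , eq = indefinite-repeats (greedy f) (disc f)
        (λ n → trans (cong disc (sym (run-design f n))) (disc-run (design f) f n))
        (λ n → reduced⇒indefinite (greedy f n) (red n))
  in e , greedy-cancel f red i (suc e) (trans eq (cong (greedy f) (ℕₚ.+-comm (suc e) i)))

-- Both digits recur in a periodic greedy design

middle : Form → ℤ
middle (_ , t , _) = t

x≡t-[t-x] : ∀ x t → x ≡ t - (t - x)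
x≡t-[t-x] = solve-∀

advance-decreases : ∀ g → Reduced g → digit g ≡ true → 0< middle g - middle (advance g)
advance-decreases g@(a , t , c) (0<a , _) eq =
  subst (λ b → 0< t - middle (step b g)) (sym eq) (subst 0<_ (x≡t-[t-x] a t) 0<a)

advance-increases : ∀ g → Reduced g → digit g ≡ false → 0< middle (advance g) - middle g
advance-increases g@(a , t , c) (_ , 0<-c) eq =
  subst (λ b → 0< middle (step b g) - t) (sym eq) (subst 0<_ (-c≡t-c-t c t) 0<-c)
  where
  -c≡t-c-t : ∀ c t → - c ≡ t - c - t
  -c≡t-c-t = solve-∀

telescope : ∀ x y z → x - y + (y - z) ≡ x - z
telescope = solve-∀

no-drift : ∀ {x y} → x ≡ y → ¬ 0< x - y
no-drift {x} refl h = ℤₚ.<-irrefl (sym (ℤₚ.+-inverseʳ x)) h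

true-or-false : ∀ b → b ≡ true ⊎ b ≡ false
true-or-false true  = inj₁ refl
true-or-false false = inj₂ refl

module Returning (f : Form) (red : ∀ n → Reduced (greedy f n)) (e : ℕ) (returns : f ≡ greedy f (suc e)) where

  greedy-period : ∀ i → greedy f (suc e ℕ.+ i) ≡ greedy f i
  greedy-period zero    = trans (cong (greedy f) (ℕₚ.+-identityʳ (suc e))) (sym returns)
  greedy-period (suc i) = trans (cong (greedy f) (ℕₚ.+-suc (suc e) i)) (cong advance (greedy-period i))

  design-periodic : PurelyPeriodic (design f)
  design-periodic = suc e , z<s , λ i → cong digit (greedy-period i)

  level : ℕ → ℤ
  level n = middle (greedy f n)

  -- Each digit 1 lowers the middle coefficient by a > 0, so it falls strictly over the digits N to
  -- N + k if no 0 occurs among them.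
  false-or-decreases : ∀ N k → (∃ λ i → N ℕ.≤ i × design f i ≡ false) ⊎ 0< level N - level (suc k ℕ.+ N)
  false-or-decreases N k with true-or-false (design f (k ℕ.+ N))
  ... | inj₂ eq = inj₁ (k ℕ.+ N , ℕₚ.m≤n+m N k , eq)
  false-or-decreases N zero | inj₁ eq = inj₂ (advance-decreases (greedy f N) (red N) eq)
  false-or-decreases N (suc k) | inj₁ eq with false-or-decreases N k
  ... | inj₁ found = inj₁ found
  ... | inj₂ dec = inj₂ (subst 0<_ (telescope (level N) (level (suc k ℕ.+ N)) (level (suc (suc k) ℕ.+ N)))
          (pos-+ dec (advance-decreases (greedy f (suc k ℕ.+ N)) (red (suc k ℕ.+ N)) eq)))

  true-or-increases : ∀ N k → (∃ λ i → N ℕ.≤ i × design f i ≡ true) ⊎ 0< level (suc k ℕ.+ N) - level N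
  true-or-increases N k with true-or-false (design f (k ℕ.+ N))
  ... | inj₁ eq = inj₁ (k ℕ.+ N , ℕₚ.m≤n+m N k , eq)
  true-or-increases N zero | inj₂ eq = inj₂ (advance-increases (greedy f N) (red N) eq)
  true-or-increases N (suc k) | inj₂ eq with true-or-increases N k
  ... | inj₁ found = inj₁ found
  ... | inj₂ inc = inj₂ (subst 0<_ (telescope (level (suc (suc k) ℕ.+ N)) (level (suc k ℕ.+ N)) (level N))
          (pos-+ (advance-increases (greedy f (suc k ℕ.+ N)) (red (suc k ℕ.+ N)) eq) inc))

  -- Over one whole period, e + 1 digits, the middle coefficient returns to its value. Digits 1
  -- alone would lower it and digits 0 alone would raise it, so both occur in every such window.
  design-notEventuallyConstant : NotEventuallyConstant (design f)
  design-notEventuallyConstant N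
    with false-or-decreases N e | true-or-increases N e
  ... | inj₂ dec | _ = ⊥-elim (no-drift (cong middle (sym (greedy-period N))) dec)
  ... | inj₁ _ | inj₂ inc = ⊥-elim (no-drift (cong middle (greedy-period N)) inc)
  ... | inj₁ (i , N≤i , Di≡false) | inj₁ (j , N≤j , Dj≡true) =
    i , j , N≤i , N≤j , λ Di≡Dj → false≢true (trans (sym Di≡false) (trans Di≡Dj Dj≡true))
    where
    false≢true : false ≢ true
    false≢true ()

-- Stern's recursion produces mediants

stern-double : ∀ n m → stern (suc n) (2 ℕ.* m) ≡ stern n m
stern-double n m rewrite ℕₚ.*-comm 2 m | m*n%n≡0 m 2 {{_}} | m*n/n≡m m 2 {{_}} = refl

stern-suc-double : ∀ n m → stern (suc n) (suc (2 ℕ.* m)) ≡ stern n m ℕ.+ stern n (suc m)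
stern-suc-double n m
  rewrite ℕₚ.*-comm 2 m | [m+kn]%n≡m%n 1 m 2 {{_}} | +-distrib-/-∣ʳ 1 {m ℕ.* 2} {2} {{_}} (n∣m*n m)
        | m*n/n≡m m 2 {{_}} | ℕₚ.+-comm m 1 = refl

-- Writing 2^n = m + 1 + e makes the truncated subtractions in the denominators exact: they give e +
-- 1 for the lower bound and e for the upper one.
trunc-gap : ∀ D n → ∃ λ e → 2 ^ n ≡ suc (trunc D n ℕ.+ e)
trunc-gap D zero = 0 , refl
trunc-gap D (suc n) with trunc-gap D n | D n
... | e , eq | true = 2 ℕ.* e , trans (cong (2 ℕ.*_) eq) (lem (trunc D n) e)
  where
  lem : ∀ m e → 2 ℕ.* suc (m ℕ.+ e) ≡ suc (2 ℕ.* m ℕ.+ 1 ℕ.+ 2 ℕ.* e)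
  lem = ℕRing.solve-∀
... | e , eq | false = suc (2 ℕ.* e) , trans (cong (2 ℕ.*_) eq) (lem (trunc D n) e)
  where
  lem : ∀ m e → 2 ℕ.* suc (m ℕ.+ e) ≡ suc (2 ℕ.* m ℕ.+ 0 ℕ.+ suc (2 ℕ.* e))
  lem = ℕRing.solve-∀

-- With m = trunc D n, the fractions lowNum / lowDen and highNum / highDen are
-- A(m / 2^n) and A((m + 1) / 2^n).
lowNum lowDen highNum highDen : (ℕ → Bool) → ℕ → ℕ
lowNum  D n = stern n (trunc D n)
lowDen  D n = stern n (2 ^ n ∸ trunc D n)
highNum D n = stern n (suc (trunc D n))
highDen D n = stern n (2 ^ n ∸ suc (trunc D n))

∸-from-sum : ∀ {N} m e → N ≡ m ℕ.+ e → N ∸ m ≡ e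
∸-from-sum m e refl = ℕₚ.m+n∸m≡n m e

module _ (D : ℕ → Bool) (n : ℕ) where

  private
    m = trunc D n
    e = proj₁ (trunc-gap D n)
    2^n≡ : 2 ^ n ≡ suc (m ℕ.+ e)
    2^n≡ = proj₂ (trunc-gap D n)
    low≡ : 2 ^ n ∸ m ≡ suc e
    low≡ = ∸-from-sum m (suc e) (trans 2^n≡ (sym (ℕₚ.+-suc m e)))
    high≡ : 2 ^ n ∸ suc m ≡ e
    high≡ = ∸-from-sum (suc m) e 2^n≡
    double-∸ : ∀ k l → 2 ℕ.* suc (m ℕ.+ e) ≡ k ℕ.+ l → 2 ^ suc n ∸ k ≡ l
    double-∸ k l eq = ∸-from-sum k l (trans (cong (2 ℕ.*_) 2^n≡) eq)
    even≡ : 2 ^ suc n ∸ 2 ℕ.* m ≡ 2 ℕ.* suc e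
    even≡ = double-∸ (2 ℕ.* m) (2 ℕ.* suc e) (lem m e)
      where
      lem : ∀ m e → 2 ℕ.* suc (m ℕ.+ e) ≡ 2 ℕ.* m ℕ.+ 2 ℕ.* suc e
      lem = ℕRing.solve-∀
    odd≡ : 2 ^ suc n ∸ suc (2 ℕ.* m) ≡ suc (2 ℕ.* e)
    odd≡ = double-∸ (suc (2 ℕ.* m)) (suc (2 ℕ.* e)) (lem m e)
      where
      lem : ∀ m e → 2 ℕ.* suc (m ℕ.+ e) ≡ suc (2 ℕ.* m) ℕ.+ suc (2 ℕ.* e)
      lem = ℕRing.solve-∀
    even′≡ : 2 ^ suc n ∸ 2 ℕ.* suc m ≡ 2 ℕ.* e
    even′≡ = double-∸ (2 ℕ.* suc m) (2 ℕ.* e) (lem m e)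
      where
      lem : ∀ m e → 2 ℕ.* suc (m ℕ.+ e) ≡ 2 ℕ.* suc m ℕ.+ 2 ℕ.* e
      lem = ℕRing.solve-∀
    -- The odd argument 2e + 1 splits into e and e + 1, the arguments of the upper and lower
    -- denominators. This mediant serves both digits: as lower bound after 1, as upper bound after
    -- 0.
    mediantDen : stern (suc n) (2 ^ suc n ∸ suc (2 ℕ.* m)) ≡ lowDen D n ℕ.+ highDen D n
    mediantDen = trans (cong (stern (suc n)) odd≡) (trans (stern-suc-double n e)
      (trans (ℕₚ.+-comm (stern n e) _) (sym (cong₂ (λ k l → stern n k ℕ.+ stern n l) low≡ high≡))))
    trunc-false : D n ≡ false → trunc D (suc n) ≡ 2 ℕ.* m
    trunc-false eq = trans (cong (λ b → 2 ℕ.* m ℕ.+ bit b) eq) (ℕₚ.+-identityʳ _)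
    trunc-true : D n ≡ true → trunc D (suc n) ≡ suc (2 ℕ.* m)
    trunc-true eq = trans (cong (λ b → 2 ℕ.* m ℕ.+ bit b) eq) (ℕₚ.+-comm _ 1)
    suc-suc-double : suc (suc (2 ℕ.* m)) ≡ 2 ℕ.* suc m
    suc-suc-double = sym (ℕₚ.*-suc 2 m)

  lowNum-false : D n ≡ false → lowNum D (suc n) ≡ lowNum D n
  lowNum-false eq = trans (cong (stern (suc n)) (trunc-false eq)) (stern-double n m)

  lowDen-false : D n ≡ false → lowDen D (suc n) ≡ lowDen D n
  lowDen-false eq = trans (cong (λ k → stern (suc n) (2 ^ suc n ∸ k)) (trunc-false eq))
    (trans (cong (stern (suc n)) even≡) (trans (stern-double n (suc e)) (cong (stern n) (sym low≡))))

  highNum-false : D n ≡ false → highNum D (suc n) ≡ lowNum D n ℕ.+ highNum D n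
  highNum-false eq = trans (cong (stern (suc n) ∘ suc) (trunc-false eq)) (stern-suc-double n m)

  highDen-false : D n ≡ false → highDen D (suc n) ≡ lowDen D n ℕ.+ highDen D n
  highDen-false eq = trans (cong (λ k → stern (suc n) (2 ^ suc n ∸ suc k)) (trunc-false eq)) mediantDen

  lowNum-true : D n ≡ true → lowNum D (suc n) ≡ lowNum D n ℕ.+ highNum D n
  lowNum-true eq = trans (cong (stern (suc n)) (trunc-true eq)) (stern-suc-double n m)

  lowDen-true : D n ≡ true → lowDen D (suc n) ≡ lowDen D n ℕ.+ highDen D n
  lowDen-true eq = trans (cong (λ k → stern (suc n) (2 ^ suc n ∸ k)) (trunc-true eq)) mediantDen

  highNum-true : D n ≡ true → highNum D (suc n) ≡ highNum D n
  highNum-true eq = trans (cong (stern (suc n)) (trans (cong suc (trunc-true eq)) suc-suc-double)) (stern-double n (suc m))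

  highDen-true : D n ≡ true → highDen D (suc n) ≡ highDen D n
  highDen-true eq = trans (cong (λ k → stern (suc n) (2 ^ suc n ∸ k)) (trans (cong suc (trunc-true eq)) suc-suc-double))
    (trans (cong (stern (suc n)) even′≡) (trans (stern-double n e) (cong (stern n) (sym high≡))))

-- Serves the infinite upper bound: there v reduces to `highNum` times r, which has to be positive.
highNum-pos : ∀ D n → 0 < highNum D n
highNum-pos D zero    = z<s
highNum-pos D (suc n) with true-or-false (D n)
... | inj₁ eq = subst (0 <_) (sym (highNum-true D n eq)) (highNum-pos D n)
... | inj₂ eq = subst (0 <_) (sym (highNum-false D n eq)) (ℕₚ.≤-trans (highNum-pos D n) (ℕₚ.m≤n+m _ (lowNum D n)))

-- Offsets of ω from its two bounds

State : Set
State = Surd × Surd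

next : Bool → State → State
next true  (u , v) = u ⊝ v , v
next false (u , v) = u , v ⊝ u

orbit : (ℕ → Bool) → State → ℕ → State
orbit D s zero    = s
orbit D s (suc n) = next (D n) (orbit D s n)

-- For ω = (p + q√d)/r and a / b < ω < a′ / b′, the pair r(bω − a), r(a′ − b′ω).
offsets : ℤ → ℤ → ℤ → ℤ → ℤ → ℤ → ℤ → State
offsets p q r a b a′ b′ = (b * p - a * r , b * q) , (a′ * r - b′ * p , - (b′ * q))

-- Offsets are linear in numerators and denominators, so a mediant as lower bound turns u into u -
-- v.
offsets-true : ∀ p q r a b a′ b′ → offsets p q r (a + a′) (b + b′) a′ b′ ≡ next true (offsets p q r a b a′ b′)
offsets-true p q r a b a′ b′ = cong (_, (a′ * r - b′ * p , - (b′ * q))) (cong₂ _,_ (eq₁ p r a b a′ b′) (eq₂ q b b′))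
  where
  eq₁ : ∀ p r a b a′ b′ → (b + b′) * p - (a + a′) * r ≡ (b * p - a * r) - (a′ * r - b′ * p)
  eq₁ = solve-∀
  eq₂ : ∀ q b b′ → (b + b′) * q ≡ b * q - - (b′ * q)
  eq₂ = solve-∀

offsets-false : ∀ p q r a b a′ b′ → offsets p q r a b (a + a′) (b + b′) ≡ next false (offsets p q r a b a′ b′)
offsets-false p q r a b a′ b′ = cong ((b * p - a * r , b * q) ,_) (cong₂ _,_ (eq₁ p r a b a′ b′) (eq₂ q b b′))
  where
  eq₁ : ∀ p r a b a′ b′ → (a + a′) * r - (b + b′) * p ≡ (a′ * r - b′ * p) - (b * p - a * r)
  eq₁ = solve-∀
  eq₂ : ∀ q b b′ → - ((b + b′) * q) ≡ - (b′ * q) - b * q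
  eq₂ = solve-∀

cong₄ : ∀ {A B : Set} (f : A → A → A → A → B) {a a′ b b′ c c′ e e′} →
  a ≡ a′ → b ≡ b′ → c ≡ c′ → e ≡ e′ → f a b c e ≡ f a′ b′ c′ e′
cong₄ f refl refl refl refl = refl

module Assembly (p q : ℤ) (r : ℕ) (D : ℕ → Bool) where

  offsetsℕ : ℕ → ℕ → ℕ → ℕ → State
  offsetsℕ a b a′ b′ = offsets p q (+ r) (+ a) (+ b) (+ a′) (+ b′)

  sternOffsets : ℕ → State
  sternOffsets n = offsetsℕ (lowNum D n) (lowDen D n) (highNum D n) (highDen D n)

  sternOffsets-orbit : ∀ n → sternOffsets n ≡ orbit D ((p , q) , (+ r , + 0)) n
  -- The starting bounds are 0/1 and 1/0, so u = rω = p + q√d and v = r.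
  sternOffsets-orbit zero = cong₂ _,_ (cong₂ _,_ (eq₁ p (+ r)) (ℤₚ.*-identityˡ q)) (cong₂ _,_ (eq₂ p (+ r)) (eq₃ q))
    where
    eq₁ : ∀ p r → + 1 * p - + 0 * r ≡ p
    eq₁ = solve-∀
    eq₂ : ∀ p r → + 1 * r - + 0 * p ≡ r
    eq₂ = solve-∀
    eq₃ : ∀ q → - (+ 0 * q) ≡ + 0
    eq₃ = solve-∀
  sternOffsets-orbit (suc n) with true-or-false (D n)
  ... | inj₁ eq =
    trans (cong₄ offsetsℕ (lowNum-true D n eq) (lowDen-true D n eq) (highNum-true D n eq) (highDen-true D n eq))
      (trans (offsets-true p q (+ r) (+ lowNum D n) (+ lowDen D n) (+ highNum D n) (+ highDen D n))
        (cong₂ next (sym eq) (sternOffsets-orbit n)))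
  ... | inj₂ eq =
    trans (cong₄ offsetsℕ (lowNum-false D n eq) (lowDen-false D n eq) (highNum-false D n eq) (highDen-false D n eq))
      (trans (offsets-false p q (+ r) (+ lowNum D n) (+ lowDen D n) (+ highNum D n) (+ highDen D n))
        (cong₂ next (sym eq) (sternOffsets-orbit n)))

-- Signs of the conjugates along an orbit

module Dynamics (d : ℕ) (ns : NonSquare d) where
  open Quadratic d ns

  -- The coefficients of N(vX - uY); subtracting v from u, or u from v, is then the substitution
  -- made by `step`.
  form : State → Form
  form (u , v) = norm v , polar u v , norm u

  form-next : ∀ b s → form (next b s) ≡ step b (form s)
  form-next true  (u , v) = cong₂ (λ t c → norm v , t , c) (polar-⊝ˡ u v) (norm-⊝ u v)
  form-next false (u , v) = cong₂ (λ a t → a , t , norm u)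
    (trans (norm-⊝-comm u v) (norm-⊝ u v))
    (polar-⊝ʳ u v)

  form-orbit : ∀ D s n → form (orbit D s n) ≡ run D (form s) n
  form-orbit D s zero    = refl
  form-orbit D s (suc n) = trans (form-next (D n) (orbit D s n)) (cong (step (D n)) (form-orbit D s n))

  Positive : State → Set
  Positive (u , v) = Pos u × Pos v

  BothPP Mixed : State → Set
  BothPP (u , v) = PP u × PP v
  Mixed (u , v) = PN u × PP v ⊎ PP u × PN v

  -- From ū < 0 < v̄ follows ū - v̄ < 0. Formally, were u - v in `PP`, adding v would put u there.
  PN-PP-Pos⇒PN : ∀ u v → PN u → PP v → Pos (u ⊝ v) → PN (u ⊝ v)
  PN-PP-Pos⇒PN u v pu pv (inj₁ pp) = ⊥-elim (PP-PN-disjoint u (PP-⊝⇒PP u v pp pv) pu)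
  PN-PP-Pos⇒PN u v pu pv (inj₂ pn) = pn

  PP-PN-Pos⇒PP : ∀ u v → PP u → PN v → Pos (u ⊝ v) → PP (u ⊝ v)
  PP-PN-Pos⇒PP u v pu pv (inj₁ pp) = pp
  PP-PN-Pos⇒PP u v pu pv (inj₂ pn) = ⊥-elim (PP-PN-disjoint u pu (PN-⊝⇒PN u v pn pv))

  mixed-next : ∀ b s → Mixed s → Positive (next b s) → Mixed (next b s)
  mixed-next true  (u , v) (inj₁ (pu , pv)) (pw , _) = inj₁ (PN-PP-Pos⇒PN u v pu pv pw , pv)
  mixed-next true  (u , v) (inj₂ (pu , pv)) (pw , _) = inj₂ (PP-PN-Pos⇒PP u v pu pv pw , pv)
  mixed-next false (u , v) (inj₁ (pu , pv)) (_ , pw) = inj₁ (pu , PP-PN-Pos⇒PP v u pv pu pw)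
  mixed-next false (u , v) (inj₂ (pu , pv)) (_ , pw) = inj₂ (pu , PN-PP-Pos⇒PN v u pv pu pw)

  mixed⇒indefinite : ∀ s → Mixed s → Indefinite (form s)
  mixed⇒indefinite (u , v) (inj₁ ((_ , 0<-Nu) , (_ , 0<Nv))) =
    subst 0<_ (sym (ℤₚ.neg-distribʳ-* (norm v) (norm u))) (pos-* 0<Nv 0<-Nu)
  mixed⇒indefinite (u , v) (inj₂ ((_ , 0<Nu) , (_ , 0<-Nv))) =
    subst 0<_ (sym (ℤₚ.neg-distribˡ-* (norm v) (norm u))) (pos-* 0<-Nv 0<Nu)

  trace : State → ℤ
  trace (u , v) = polar u v

  trace-pos : ∀ s → BothPP s → 0< trace s
  trace-pos (u , v) (pu , pv) = polar-pos u v pu pv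

  -- The new conjugate is negative, which gives `Mixed`, or positive; then tr(u v̄)/2 has dropped by
  -- the norm of the element subtracted.
  bothPP-next : ∀ b s → BothPP s → Positive (next b s) →
    Mixed (next b s) ⊎ BothPP (next b s) × 0< trace s - trace (next b s)
  bothPP-next true (u , v) (pu , pv) (inj₂ pw , _) = inj₁ (inj₁ (pw , pv))
  bothPP-next true (u , v) (pu , pv) (inj₁ pw , _) =
    inj₂ ((pw , pv) , subst 0<_ (trans (x≡t-[t-x] (norm v) (polar u v))
      (cong (λ t → polar u v - t) (sym (polar-⊝ˡ u v)))) (proj₂ pv))
  bothPP-next false (u , v) (pu , pv) (_ , inj₂ pw) = inj₁ (inj₂ (pu , pw))
  bothPP-next false (u , v) (pu , pv) (_ , inj₁ pw) =
    inj₂ ((pu , pw) , subst 0<_ (trans (x≡t-[t-x] (norm u) (polar u v))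
      (cong (λ t → polar u v - t) (sym (polar-⊝ʳ u v)))) (proj₂ pu))

  pos-pred : ∀ {x} → 0< x → + 0 ℤ.≤ x - + 1
  pos-pred {+ suc n} _ = ℤ.+≤+ ℕ.z≤n
  pos-pred {+ zero} (ℤ.+<+ ())

  bound-decreases : ∀ m t t′ → 0< + suc m - t → 0< t - t′ → 0< + m - t′
  bound-decreases m t t′ h h′ = subst 0<_ (eq (+ m) t t′) (pos-+-nonneg h (pos-pred h′))
    where
    eq : ∀ m t t′ → (+ 1 + m - t) + (t - t′ - + 1) ≡ m - t′
    eq = solve-∀

  module _ (D : ℕ → Bool) (s : State) (positive : ∀ n → Positive (orbit D s n)) where

    -- `m` is fuel exceeding the trace. Within `BothPP` the trace is a positive integer that loses
    -- at least 1 per step, so the orbit becomes mixed before the fuel runs out.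
    eventually-mixed : ∀ m n → BothPP (orbit D s n) → 0< + m - trace (orbit D s n) → ∃ λ N → Mixed (orbit D s N)
    eventually-mixed zero n both h = ⊥-elim (pos-asym (trace (orbit D s n)) (trace-pos (orbit D s n) both)
      (subst 0<_ (ℤₚ.+-identityˡ (- trace (orbit D s n))) h))
    eventually-mixed (suc m) n both h with bothPP-next (D n) (orbit D s n) both (positive (suc n))
    ... | inj₁ mixed = suc n , mixed
    ... | inj₂ (both′ , dec) = eventually-mixed m (suc n) both′
            (bound-decreases m (trace (orbit D s n)) (trace (orbit D s (suc n))) h dec)

    mixed-forever : ∀ {N} → Mixed (orbit D s N) → ∀ {n} → N ℕ.≤′ n → Mixed (orbit D s n)
    mixed-forever mixed (ℕ.≤′-reflexive refl) = mixed
    mixed-forever mixed (ℕ.≤′-step {n = n} N≤n) =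
      mixed-next (D n) (orbit D s n) (mixed-forever mixed N≤n) (positive (suc n))

    -- Periodicity would carry N u · N v < 0 from the mixed tail back to the initial form, whose
    -- outer coefficients are both positive.
    bothPP-aperiodic : BothPP s → ¬ PurelyPeriodic D
    bothPP-aperiodic both (k , 0<k , per) =
      pos-asym (norm v * norm u) (pos-* (proj₂ (proj₂ both)) (proj₂ (proj₁ both))) indefinite
      where
      u = proj₁ s
      v = proj₂ s
      bound : 0< + suc ∣ trace s ∣ - trace s
      bound = <⇒0<∸ (subst (ℤ._< + suc ∣ trace s ∣)
        (ℤₚ.0≤i⇒+∣i∣≡i (ℤₚ.<⇒≤ (trace-pos s both))) (ℤ.+<+ (ℕₚ.n<1+n _)))
      eventual : ∃ λ N → Mixed (orbit D s N)
      eventual = eventually-mixed (suc ∣ trace s ∣) 0 both bound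
      indefinite : Indefinite (form s)
      indefinite = period-eventually-indefinite 0<k per (proj₁ eventual) λ n N≤n →
        subst Indefinite (form-orbit D s n) (mixed⇒indefinite (orbit D s n)
          (mixed-forever (proj₂ eventual) (ℕₚ.≤⇒≤′ N≤n)))

  -- The greedy orbit for a negative conjugate

  PN,PP : State → Set
  PN,PP (u , v) = PN u × PP v

  greedy-next : ∀ s → PN,PP s → PN,PP (next (digit (form s)) s)
  greedy-next (u , v) (pu , pv) with PN-PP-⊝ u v pu pv
  ... | inj₁ (pw , 0<-N) = subst (λ b → PN,PP (next b (u , v)))
          (sym (trans (cong isNegative (sym (norm-⊝ u v))) (isNegative-neg 0<-N))) (pw , pv)
  ... | inj₂ (pw , 0<N) = subst (λ b → PN,PP (next b (u , v)))
          (sym (trans (cong isNegative (sym (norm-⊝ u v))) (isNegative-pos 0<N))) (pu , pw)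

  form-greedy : ∀ s n → form (orbit (design (form s)) s n) ≡ greedy (form s) n
  form-greedy s n = trans (form-orbit (design (form s)) s n) (run-design (form s) n)

  greedy-orbit : ∀ s → PN,PP s → ∀ n → PN,PP (orbit (design (form s)) s n)
  greedy-orbit s h zero = h
  -- `design` reads its digits from the greedy forms; `form-greedy` identifies them with the forms
  -- of the orbit, which `greedy-next` needs.
  greedy-orbit s h (suc n) = subst (λ f → PN,PP (next (digit f) (orbit (design (form s)) s n)))
    (form-greedy s n) (greedy-next (orbit (design (form s)) s n) (greedy-orbit s h n))

  greedy-reduced : ∀ s → PN,PP s → ∀ n → Reduced (greedy (form s) n)
  greedy-reduced s h n = subst Reduced (form-greedy s n) (reduced (orbit (design (form s)) s n) (greedy-orbit s h n))
    where
    reduced : ∀ s → PN,PP s → Reduced (form s)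
    reduced (u , v) ((_ , 0<-Nu) , (_ , 0<Nv)) = 0<Nv , 0<-Nu

  -- Assembly as positivity of offsets, and the two cases

  PP-rational : ∀ {x} → 0< x → PP (x , + 0)
  PP-rational {x} 0<x = 0<x , subst 0<_ (eq x δ) (pos-* 0<x 0<x)
    where
    eq : ∀ x δ → x * x ≡ x * x - + 0 * + 0 * δ
    eq = solve-∀

  norm-conj : ∀ x y → norm (x , - y) ≡ norm (x , y)
  norm-conj x y = eq x y δ
    where
    eq : ∀ x y δ → x * x - - y * - y * δ ≡ x * x - y * y * δ
    eq = solve-∀

  norm-neg : ∀ x y → norm (- x , y) ≡ norm (x , y)
  norm-neg x y = eq x y δ
    where
    eq : ∀ x y δ → - x * - x - y * y * δ ≡ x * x - y * y * δ
    eq = solve-∀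

  module _ (p q : ℤ) (r : ℕ) (0<r : 0 < r) where

    initial : State
    initial = (p , q) , (+ r , + 0)

    open Assembly p q r

    positive⇒assembles : ∀ D → (∀ n → Positive (orbit D initial n)) → AssemblesTo D p q r d
    positive⇒assembles D pos n = assembles (subst Positive (sym (sternOffsets-orbit D n)) (pos n))
      where
      assembles : Positive (sternOffsets D n) → _
      -- The surd inequality is supplied even where the upper denominator is 0: it then only says
      -- that `highNum` times r is positive.
      assembles (pu , pv) = Pos⇒PosSurd _ _ pu , inj₂ (Pos⇒PosSurd _ _ pv)

    assembles⇒positive : ∀ D → AssemblesTo D p q r d → ∀ n → Positive (orbit D initial n)
    assembles⇒positive D assembles n = subst Positive (sternOffsets-orbit D n)
      (PosSurd⇒Pos _ _ (proj₁ (assembles n)) , upper (proj₂ (assembles n)))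
      where
      eq₁ : ∀ x p → x ≡ x - + 0 * p
      eq₁ = solve-∀
      eq₂ : ∀ q → + 0 ≡ - (+ 0 * q)
      eq₂ = solve-∀
      upper : highDen D n ≡ 0 ⊎ RatAbove (highNum D n) (highDen D n) p q r d → Pos (proj₂ (sternOffsets D n))
      upper (inj₂ above) = PosSurd⇒Pos _ _ above
      upper (inj₁ b′≡0) = subst (λ b′ → Pos (+ highNum D n * + r - + b′ * p , - (+ b′ * q))) (sym b′≡0)
        (subst Pos (cong₂ _,_ (eq₁ (+ highNum D n * + r) p) (eq₂ q))
          (inj₁ (PP-rational (pos-* (ℤ.+<+ (highNum-pos D n)) (ℤ.+<+ 0<r)))))

    PP⇒notPure : PP (p , q) → ¬ IsPure p q r d
    PP⇒notPure pu (D , _ , per , assembles) =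
      bothPP-aperiodic D initial (assembles⇒positive D assembles) (pu , PP-rational (ℤ.+<+ 0<r)) per

    PN⇒pure : PN (p , q) → IsPure p q r d
    PN⇒pure pu = design f , design-notEventuallyConstant , design-periodic ,
      positive⇒assembles (design f) (λ n → inj₂ (proj₁ (mixed n)) , inj₁ (proj₂ (mixed n)))
      where
      f = form initial
      start : PN,PP initial
      start = pu , PP-rational (ℤ.+<+ 0<r)
      mixed : ∀ n → PN,PP (orbit (design f) initial n)
      mixed = greedy-orbit initial start
      returns : ∃ λ e → f ≡ greedy f (suc e)
      returns = greedy-returns f (greedy-reduced initial start)
      open Returning f (greedy-reduced initial start) (proj₁ returns) (proj₂ returns)

  PP⇒conj-pos : ∀ p q → PP (p , q) → PosSurd p (- q) d
  PP⇒conj-pos p q (0<p , 0<N) = Pos⇒PosSurd p (- q) (inj₁ (0<p , subst 0<_ (sym (norm-conj p q)) 0<N))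

  -- With p + q√d = rω, the surd -p + q√d is -rω′.
  PN⇒conj-neg : ∀ p q → PN (p , q) → PosSurd (- p) q d
  PN⇒conj-neg p q (0<q , 0<-N) = Pos⇒PosSurd (- p) q (inj₂ (0<q , subst (λ n → 0< - n) (sym (norm-neg p q)) 0<-N))

  PP⇒¬conj-neg : ∀ p q → PP (p , q) → ¬ PosSurd (- p) q d
  PP⇒¬conj-neg p q (0<p , 0<N) h with PosSurd⇒Pos (- p) q h
  ... | inj₁ (0<-p , _) = pos-asym p 0<p 0<-p
  ... | inj₂ (_ , 0<-N) = pos-asym _ 0<N (subst (λ n → 0< - n) (norm-neg p q) 0<-N)

  PN⇒¬conj-pos : ∀ p q → PN (p , q) → ¬ PosSurd p (- q) d
  PN⇒¬conj-pos p q (0<q , 0<-N) h with PosSurd⇒Pos p (- q) h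
  ... | inj₁ (_ , 0<N) = pos-asym _ (subst 0<_ (norm-conj p q) 0<N) 0<-N
  ... | inj₂ (0<-q , _) = pos-asym q 0<q 0<-q

theorem7p9 : (p q : ℤ) (r d : ℕ) → NonSquare d → q ≢ + 0 → 0 < r →
    PosSurd p q d →
    (IsPure p q r d ⇔ PosSurd (- p) q d)
    × (IsNonPure p q r d ⇔ PosSurd p (- q) d)
-- ω > 0 leaves the cases ω′ > 0 and ω′ < 0. Each settles purity and both sign conditions, so every
-- implication has a true conclusion or a false premise.
theorem7p9 p q r d ns _ 0<r ω>0 with Quadratic.PosSurd⇒Pos d ns p q ω>0
... | inj₁ pp = mk⇔ (λ pure → ⊥-elim (notPure pure)) (λ neg → ⊥-elim (PP⇒¬conj-neg p q pp neg))
              , mk⇔ (λ _ → PP⇒conj-pos p q pp) (λ _ → notPure)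
  where
  open Dynamics d ns
  notPure : IsNonPure p q r d
  notPure = PP⇒notPure p q r 0<r pp
... | inj₂ pn = mk⇔ (λ _ → PN⇒conj-neg p q pn) (λ _ → pure)
              , mk⇔ (λ nonPure → ⊥-elim (nonPure pure)) (λ pos → ⊥-elim (PN⇒¬conj-pos p q pn pos))
  where
  open Dynamics d ns
  pure : IsPure p q r d
  pure = PN⇒pure p q r 0<r pn
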